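{- Let $G$ be a graph of treelength at most $\ell$. Then $\mathrm{pc}_r(G,k)\in O\big(k\cdot r^2(\ell+1)^k\big)$. That is, there exists an absolute constant $C>0$ such that for every nonnegative integer $\ell$, every graph $G$ of treelength at most $\ell$, every positive integer $r$ and every integer $k$ with $1\le k\le |V(G)|$, one has $\mathrm{pc}_r(G,k)\le C\, k\, r^2(\ell+1)^k$.
   Context: All graphs are finite, simple, loopless and undirected. $\mathrm{dist}_G(u,v)$ is the usual graph distance (number of edges of a shortest path, $+\infty$ if there is none). For an integer $r$, let $\mathrm{Cap}_r(\ell)=\ell$ if $\ell\le r$ and $\mathrm{Cap}_r(\ell)=+\infty$ otherwise. For $A\subseteq V(G)$ and $v\in V(G)$, the $r$-profile of $v$ with respect to $A$ is the function $p_r(v,A):A\to\mathbb N\cup\{+\infty\}$, $a\mapsto \mathrm{Cap}_r(\mathrm{dist}_G(a,v))$. Let $\mathrm{pc}_r(G,A)=\big|\{p_r(v,A): v\in V(G)\}\setminus\{a\mapsto+\infty\}\big|$ (the number of distinct $r$-profiles with respect to $A$, not counting the constant $+\infty$ profile), and let $\mathrm{pc}_r(G,k)=\max\{\mathrm{pc}_r(G,A): A\subseteq V(G), |A|=k\}$ (the $r$-profile complexity of $G$). A tree representation of $G$ is a pair $(T,\{T_v\}_{v\in V(G)})$ where $T$ is a tree, each $T_v$ is a subtree of $T$, and $T_u,T_v$ share a node of $T$ whenever $uv\in E(G)$. The bag at a node $t$ of $T$ is $\beta(t)=\{v\in V(G): t\in V(T_v)\}$. The length of the representation is $\max_{t\in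 V(T)}\max_{u,v\in\beta(t)}\mathrm{dist}_G(u,v)$, and the treelength of $G$ is the minimum length of a tree representation of $G$. -}

module Defs where

open import Data.Fin.Base using (Fin; zero; suc)
open import Data.Fin.Properties as Fin using (any?; all?; injective⇒≤)
open import Data.Fin.Subset using (Subset; inside; outside; Nonempty; _∈_; ∣_∣)
open import Data.Fin.Subset.Properties using (_∈?_)
open import Data.List.Base as List
  using (List; []; _∷_; _++_; allFin; cartesianProductWith; deduplicate; filter; lookup)
import Data.List.Extrema as Extrema
open import Data.List.Extrema.Nat as ExtremaNat using ()
open import Data.List.Membership.Propositional using () renaming (_∈_ to _∈ₗ_)
open import Data.List.Membership.Propositional.Properties using (∈-lookup; ∈-map⁺; ∈-++⁺ˡ; ∈-++⁺ʳ)
open import Data.List.Relation.Unary.All as All using (All)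
open import Data.List.Relation.Unary.All.Properties using (¬Any⇒All¬)
open import Data.List.Relation.Unary.AllPairs using ([]; _∷_)
open import Data.List.Relation.Unary.Any as Any using (here; there)
open import Data.List.Relation.Unary.Unique.Propositional using (Unique)
open import Data.Nat.Base using (ℕ; zero; suc; _≤_; _<_; NonZero; z≤n; s≤s)
open import Data.Nat.Properties as ℕ
  using (_≟_; _≤?_; ≤-refl; ≤-reflexive; ≤-trans; ≤-antisym; m≤n⇒m≤1+n; m≤n⇒m<n∨m≡n; ≮⇒≥; suc-injective)
open import Data.Product.Base using (∃; _×_; _,_; proj₁; proj₂)
open import Data.Sum.Base using (_⊎_; inj₁; inj₂)
open import Data.Vec.Base using ([]; _∷_)
open import Data.Vec.Properties.WithK using ([]=-irrelevant)
open import Function.Base using (case_of_)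
open import Function.Bundles using (_⇔_; mk⇔)
open import Level using (0ℓ)
open import Relation.Binary.Bundles using (TotalOrder)
open import Relation.Binary.Construct.Add.Supremum.NonStrict _≤_ using (_≤⁺_; ≤⁺-trans; ≤⁺-isTotalOrder-≡)
open import Relation.Binary.Construct.Closure.ReflexiveTransitive using (Star; ε; _◅_)
open import Relation.Binary.Core using (Rel)
open import Relation.Binary.Definitions using (Decidable; Symmetric)
open import Relation.Binary.PropositionalEquality using (_≡_; refl; sym; cong; subst)
open import Relation.Nullary using (¬_; Dec; yes; no; contradiction)
open import Relation.Nullary.Construct.Add.Supremum using (_⁺; ⊤⁺; [_]; ≡-dec)
open import Relation.Nullary.Decidable using (map′; _×-dec_; ¬?)

private
  variable
    n : ℕ

ℕ∞ : Set
ℕ∞ = ℕ ⁺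

ℕ∞-totalOrder : TotalOrder 0ℓ 0ℓ 0ℓ
ℕ∞-totalOrder = record { isTotalOrder = ≤⁺-isTotalOrder-≡ ℕ.≤-isTotalOrder }

-- The maximum of an empty list is 0.
max∞ : List ℕ∞ → ℕ∞
max∞ = Extrema.max ℕ∞-totalOrder [ 0 ]

record Graph (n : ℕ) : Set₁ where
  field
    Adj       : Rel (Fin n) 0ℓ
    adj?      : Decidable Adj
    symmetric : Symmetric Adj
    loopless  : ∀ {u} → ¬ Adj u u

Walk : Graph n → Fin n → Fin n → Set
Walk G = Star (Graph.Adj G)

module _ {R : Rel (Fin n) 0ℓ} where

  walkLength : ∀ {u v} → Star R u v → ℕ
  walkLength ε       = 0
  walkLength (_ ◅ w) = suc (walkLength w)

  walkVertices : ∀ {u v} → Star R u v → List (Fin n)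
  walkVertices {u} ε       = u ∷ []
  walkVertices {u} (_ ◅ w) = u ∷ walkVertices w

record Path (G : Graph n) (u v : Fin n) : Set where
  constructor mkPath
  field
    walk   : Walk G u v
    simple : Unique (walkVertices walk)

module _ {G : Graph n} where

  pathLength : ∀ {u v} → Path G u v → ℕ
  pathLength p = walkLength (Path.walk p)

  pathVertices : ∀ {u v} → Path G u v → List (Fin n)
  pathVertices p = walkVertices (Path.walk p)

IsDistance : (G : Graph n) (u v : Fin n) → ℕ∞ → Set
IsDistance G u v [ d ] = (∃ λ (p : Path G u v) → pathLength p ≡ d)
                       × (∀ (p : Path G u v) → d ≤ pathLength p)
IsDistance G u v ⊤⁺    = ¬ Path G u v

module _ {G : Graph n} where

  open Graph G

  suffix : ∀ {u v w} (p : Path G w v) → u ∈ₗ pathVertices p →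
           ∃ λ (q : Path G u v) → pathLength q ≤ pathLength p
  suffix p@(mkPath ε       _)       (here refl) = p , ≤-refl
  suffix p@(mkPath (_ ◅ _) _)       (here refl) = p , ≤-refl
  suffix   (mkPath (_ ◅ w) (_ ∷ s)) (there u∈w) =
    let q , q≤w = suffix (mkPath w s) u∈w in q , m≤n⇒m≤1+n q≤w

  toPath : ∀ {u v} (w : Walk G u v) → ∃ λ (p : Path G u v) → pathLength p ≤ walkLength w
  toPath ε = mkPath ε (All.[] ∷ []) , z≤n
  toPath {u} (e ◅ w) with toPath w
  ... | p , p≤w with Any.any? (u Fin.≟_) (pathVertices p)
  ...   | yes u∈p = let q , q≤p = suffix p u∈p in q , m≤n⇒m≤1+n (≤-trans q≤p p≤w)
  ...   | no  u∉p = mkPath (e ◅ Path.walk p) (¬Any⇒All¬ _ u∉p ∷ Path.simple p) , s≤s p≤w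

  walkVertices-length : ∀ {u v} (w : Walk G u v) → List.length (walkVertices w) ≡ suc (walkLength w)
  walkVertices-length ε       = refl
  walkVertices-length (_ ◅ w) = cong suc (walkVertices-length w)

  lookup-injective : ∀ {xs : List (Fin n)} → Unique xs → ∀ {i j} → lookup xs i ≡ lookup xs j → i ≡ j
  lookup-injective (_    ∷ _) {zero}  {zero}  _  = refl
  lookup-injective (x∉xs ∷ _) {zero}  {suc j} eq = contradiction eq (All.lookup x∉xs (∈-lookup j))
  lookup-injective (x∉xs ∷ _) {suc i} {zero}  eq = contradiction (sym eq) (All.lookup x∉xs (∈-lookup i))
  lookup-injective (_    ∷ s) {suc i} {suc j} eq = cong suc (lookup-injective s eq)

  path-bounded : ∀ {u v} (p : Path G u v) → pathLength p < n
  path-bounded (mkPath w s) =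
    subst (_≤ n) (walkVertices-length w) (injective⇒≤ (lookup-injective s))

  WalkOfLength : Fin n → Fin n → ℕ → Set
  WalkOfLength u v d = ∃ λ (w : Walk G u v) → walkLength w ≡ d

  walkOfLength? : ∀ u v d → Dec (WalkOfLength u v d)
  walkOfLength? u v zero = map′ (λ where refl → ε , refl) (λ where (ε , _) → refl) (u Fin.≟ v)
  walkOfLength? u v (suc d) =
    map′ (λ (_ , e , w , eq) → e ◅ w , cong suc eq)
         (λ where (e ◅ w , eq) → _ , e , w , suc-injective eq)
         (any? λ x → adj? u x ×-dec walkOfLength? x v d)

leastWitness : {P : ℕ → Set} → (∀ d → Dec (P d)) → ∀ b →
               (∃ λ d → P d × (∀ {e} → e < d → ¬ P e)) ⊎ (∀ {e} → e < b → ¬ P e)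
leastWitness P? zero = inj₂ λ ()
leastWitness P? (suc b) with leastWitness P? b
... | inj₁ found = inj₁ found
... | inj₂ none with P? b
...   | yes Pb = inj₁ (b , Pb , none)
...   | no ¬Pb = inj₂ λ where
  (s≤s e≤b) Pe → case m≤n⇒m<n∨m≡n e≤b of λ where
    (inj₁ e<b)  → none e<b Pe
    (inj₂ refl) → ¬Pb Pe

distance-exists : (G : Graph n) (u v : Fin n) → ∃ (IsDistance G u v)
distance-exists {n} G u v with leastWitness (walkOfLength? {G = G} u v) n
... | inj₂ none = ⊤⁺ , λ p → none (path-bounded p) (Path.walk p , refl)
... | inj₁ (d , (w , w≡d) , minimal) = [ d ] , (p , ≤-antisym p≤d (shortest p)) , shortest
  where
  shortest : ∀ q → d ≤ pathLength q
  shortest q = ≮⇒≥ λ q<d → minimal q<d (Path.walk q , refl)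
  p   = proj₁ (toPath w)
  p≤d = ≤-trans (proj₂ (toPath w)) (≤-reflexive w≡d)

dist : Graph n → Fin n → Fin n → ℕ∞
dist G u v = proj₁ (distance-exists G u v)

dist-isDistance : (G : Graph n) (u v : Fin n) → IsDistance G u v (dist G u v)
dist-isDistance G u v = proj₂ (distance-exists G u v)

cap : ℕ → ℕ∞ → ℕ∞
cap r ⊤⁺ = ⊤⁺
cap r [ d ] with d ≤? r
... | yes _ = [ d ]
... | no  _ = ⊤⁺

Profile : Subset n → Set
Profile {n} A = (a : Fin n) → a ∈ A → ℕ∞

profile : ℕ → Graph n → (A : Subset n) → Fin n → Profile A
profile r G A v a _ = cap r (dist G a v)

module _ {A : Subset n} where

  infix 4 _≈ₚ_ _≈ₚ?_

  _≈ₚ_ : Rel (Profile A) 0ℓ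
  p ≈ₚ q = ∀ a (a∈A : a ∈ A) → p a a∈A ≡ q a a∈A

  _≈ₚ?_ : Decidable _≈ₚ_
  p ≈ₚ? q = all? agree?
    where
    agree? : ∀ a → Dec ((a∈A : a ∈ A) → p a a∈A ≡ q a a∈A)
    agree? a with a ∈? A
    ... | no  a∉A = yes λ a∈A → contradiction a∈A a∉A
    ... | yes a∈A = map′ (λ eq a∈A′ → subst (λ m → p a m ≡ q a m) ([]=-irrelevant a∈A a∈A′) eq)
                         (λ eq → eq a∈A)
                         (≡-dec _≟_ (p a a∈A) (q a a∈A))

  ∞ₚ : Profile A
  ∞ₚ _ _ = ⊤⁺

-- The number of ≈ₚ-classes of profiles different from ∞ₚ: deduplication keeps
-- one representative of each class.
profileCount : ℕ → (G : Graph n) → Subset n → ℕ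
profileCount {n} r G A =
  List.length (deduplicate _≈ₚ?_ (filter (λ p → ¬? (p ≈ₚ? ∞ₚ)) (List.map (profile r G A) (allFin n))))

subsets : ∀ n → List (Subset n)
subsets zero    = [] ∷ []
subsets (suc n) = List.map (outside ∷_) (subsets n) ++ List.map (inside ∷_) (subsets n)

∈-subsets : (A : Subset n) → A ∈ₗ subsets n
∈-subsets []            = here refl
∈-subsets (outside ∷ A) = ∈-++⁺ˡ (∈-map⁺ (outside ∷_) (∈-subsets A))
∈-subsets (inside  ∷ A) = ∈-++⁺ʳ _ (∈-map⁺ (inside ∷_) (∈-subsets A))

-- When k > n there is no A to maximise over, and the value is 0.
profileComplexity : ℕ → Graph n → ℕ → ℕ
profileComplexity {n} r G k =
  ExtremaNat.max 0 (List.map (profileCount r G) (filter (λ A → ∣ A ∣ ≟ k) (subsets n)))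

Connected : Graph n → Set
Connected G = ∀ u v → Path G u v

record Cycle (G : Graph n) : Set where
  field
    {start end} : Fin n
    path        : Path G start end
    long        : 2 ≤ pathLength path
    closing     : Graph.Adj G end start

record IsTree (T : Graph n) : Set where
  field
    nonempty  : NonZero n
    connected : Connected T
    acyclic   : ¬ Cycle T

-- A connected subgraph of a tree is a tree and is induced by its node set, so
-- a subtree is given by a nonempty node set S connected inside S.
record IsSubtree {m} (T : Graph m) (S : Subset m) : Set where
  field
    nonempty  : Nonempty S
    connected : ∀ {s t} → s ∈ S → t ∈ S → ∃ λ (p : Path T s t) → All (_∈ S) (pathVertices p)

record TreeRepresentation (G : Graph n) : Set₁ where
  field
    {nodes}   : ℕ
    tree      : Graph nodes
    isTree    : IsTree tree
    subtree   : Fin n → Subset nodes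
    isSubtree : ∀ v → IsSubtree tree (subtree v)
    share     : ∀ {u v} → Graph.Adj G u v → ∃ λ t → t ∈ subtree u × t ∈ subtree v

  bag : Fin nodes → List (Fin n)
  bag t = filter (λ v → t ∈? subtree v) (allFin n)

  bagDiameter : Fin nodes → ℕ∞
  bagDiameter t = max∞ (cartesianProductWith (dist G) (bag t) (bag t))

  repLength : ℕ∞
  repLength = max∞ (List.map bagDiameter (allFin nodes))

open TreeRepresentation using (repLength)

IsTreelength : Graph n → ℕ∞ → Set₁
IsTreelength G m = (∃ λ (R : TreeRepresentation G) → repLength R ≡ m)
                 × (∀ (R : TreeRepresentation G) → m ≤⁺ repLength R)

-- The treelength is a minimum over an infinite family, so it is bounded here
-- without first being computed; treelength≤⇔ relates the two.
TreelengthAtMost : Graph n → ℕ → Set₁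
TreelengthAtMost G ℓ = ∃ λ (R : TreeRepresentation G) → repLength R ≤⁺ [ ℓ ]

treelength≤⇔ : {G : Graph n} {m : ℕ∞} {ℓ : ℕ} →
               IsTreelength G m → (m ≤⁺ [ ℓ ] ⇔ TreelengthAtMost G ℓ)
treelength≤⇔ ((R , refl) , minimal) =
  mk⇔ (λ m≤ℓ → R , m≤ℓ) (λ (S , S≤ℓ) → ≤⁺-trans ≤-trans (minimal S) S≤ℓ)

{-# OPTIONS --safe #-}

-- Root the tree, represent each vertex by a node of its subtree, and call the
-- nodes of the vertices of A marks.  The sets of marks below the nodes form a
-- laminar family, so there are only O(k) nonempty ones.  For a node s, let D be the
-- first nonempty such set on the way from s to the root: the lowest node with
-- set D separates s from the marks in D, the topmost one from the other marks.
-- Every walk from v to a ∈ A therefore meets the bag of one of two gates, chosen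
-- among O(k) pairs.  As bags have diameter at most ℓ, dist(a, v) exceeds the sum
-- of the distances of a and of v to the bag by a defect between 0 and ℓ.  Hence
-- the pair of gates, the two distances from v to their bags, cut off at r + 1,
-- and the defects determine the profile of v: O(k) · (r + 2)² · (ℓ + 1)ᵏ codes.

module Submission where

open import Defs
open import Data.Bool.Base using (Bool; true; if_then_else_)
open import Data.Bool.Properties using (if-float)
open import Data.Fin.Base using (Fin; zero; suc) renaming (_<_ to _Fin<_)
open import Data.Fin.Properties as Fin using (any?; pigeonhole)
open import Data.Fin.Subset using (Subset; inside; outside; Nonempty; _∈_; ∣_∣)
open import Data.Fin.Subset.Properties using (_∈?_)
open import Data.List.Base as List using (List; []; _∷_; length; allFin)
import Data.List.Extrema as Extrema
import Data.List.Extrema.Nat as ExtremaNat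
open import Data.List.Membership.Propositional using (lose) renaming (_∈_ to _∈ₗ_)
open import Data.List.Membership.Propositional.Properties
  using (∈-map⁺; ∈-allFin; ∈-lookup; ∈-upTo⁺; ∈-filter⁺; ∈-cartesianProductWith⁺)
open import Data.List.Properties using (length-map; length-++; length-upTo)
open import Data.List.Relation.Binary.Subset.Propositional using (_⊆_)
open import Data.List.Relation.Unary.All as All using (All; []; _∷_)
import Data.List.Relation.Unary.All.Properties as All
open import Data.List.Relation.Unary.All.Properties using (¬Any⇒All¬; All¬⇒¬Any; all-filter)
open import Data.List.Relation.Unary.AllPairs using (AllPairs; []; _∷_)
import Data.List.Relation.Unary.AllPairs.Properties as AllPairs
open import Data.List.Relation.Unary.Any as Any using (Any; here; there)
open import Data.List.Relation.Unary.Any.Properties using (lookup-index)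
open import Data.List.Relation.Unary.Unique.Propositional using (Unique)
open import Data.Nat using (ℕ; zero; suc; _+_; _*_; _∸_; _^_; _≤_; _<_; z≤n; s≤s)
import Data.Nat.Properties as ℕ
open import Data.Nat.Solver using (module +-*-Solver)
open import Data.Product using (∃; ∃₂; _×_; _,_; proj₁; proj₂)
open import Data.Sum using (_⊎_; inj₁; inj₂)
open import Data.Vec.Base using ([]; _∷_; here; there)
import Data.Vec.Functional as Vector
open import Function.Base using (_∘_; case_of_)
open import Level using (0ℓ)
open import Relation.Binary.Construct.Add.Supremum.NonStrict _≤_ using (_≤⁺_; [_]; ≤⁺-trans)
open import Relation.Binary.Construct.Closure.ReflexiveTransitive using (Star; ε; _◅_; _◅◅_)
open import Relation.Binary.Core using (Rel)
open import Relation.Binary.Definitions using (Decidable; Reflexive; Transitive; Symmetric)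
open import Relation.Binary.PropositionalEquality
open import Relation.Nullary using (¬_; Dec; yes; no; does; contradiction)
open import Relation.Nullary.Construct.Add.Supremum using (⊤⁺; [_])
open import Relation.Nullary.Decidable using (_×-dec_; _→-dec_; ¬?)

-- Walks

module _ {n} {R : Rel (Fin n) 0ℓ} where

  start∈ : ∀ {u v} (w : Star R u v) → u ∈ₗ walkVertices w
  start∈ ε       = here refl
  start∈ (_ ◅ _) = here refl

  end∈ : ∀ {u v} (w : Star R u v) → v ∈ₗ walkVertices w
  end∈ ε       = here refl
  end∈ (_ ◅ w) = there (end∈ w)

  walkLength-◅◅ : ∀ {u v x} (w : Star R u v) (w′ : Star R v x) →
                  walkLength (w ◅◅ w′) ≡ walkLength w + walkLength w′
  walkLength-◅◅ ε       w′ = refl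
  walkLength-◅◅ (_ ◅ w) w′ = cong suc (walkLength-◅◅ w w′)

  ∈-◅◅⁻ : ∀ {u v x z} (w : Star R u v) (w′ : Star R v x) →
          z ∈ₗ walkVertices (w ◅◅ w′) → z ∈ₗ walkVertices w ⊎ z ∈ₗ walkVertices w′
  ∈-◅◅⁻ ε       w′ z∈         = inj₂ z∈
  ∈-◅◅⁻ (_ ◅ w) w′ (here eq)  = inj₁ (here eq)
  ∈-◅◅⁻ (_ ◅ w) w′ (there z∈) with ∈-◅◅⁻ w w′ z∈
  ... | inj₁ z∈w  = inj₁ (there z∈w)
  ... | inj₂ z∈w′ = inj₂ z∈w′

  ∈-◅◅⁺ˡ : ∀ {u v x} (w : Star R u v) (w′ : Star R v x) → walkVertices w ⊆ walkVertices (w ◅◅ w′)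
  ∈-◅◅⁺ˡ ε       w′ (here refl) = start∈ w′
  ∈-◅◅⁺ˡ (_ ◅ w) w′ (here eq)   = here eq
  ∈-◅◅⁺ˡ (_ ◅ w) w′ (there z∈)  = there (∈-◅◅⁺ˡ w w′ z∈)

  ∈-◅◅⁺ʳ : ∀ {u v x} (w : Star R u v) (w′ : Star R v x) → walkVertices w′ ⊆ walkVertices (w ◅◅ w′)
  ∈-◅◅⁺ʳ ε       w′ z∈ = z∈
  ∈-◅◅⁺ʳ (_ ◅ w) w′ z∈ = there (∈-◅◅⁺ʳ w w′ z∈)

  splitAt : ∀ {u v z} (w : Star R u v) → z ∈ₗ walkVertices w →
            ∃₂ λ (w₁ : Star R u z) (w₂ : Star R z v) → w ≡ w₁ ◅◅ w₂
  splitAt ε       (here refl) = ε , ε , refl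
  splitAt (e ◅ w) (here refl) = ε , e ◅ w , refl
  splitAt (e ◅ w) (there z∈)  =
    let w₁ , w₂ , eq = splitAt w z∈ in e ◅ w₁ , w₂ , cong (e ◅_) eq

  reversal : Symmetric R → ∀ {u v} (w : Star R u v) → ∃ λ (w′ : Star R v u) →
             walkVertices w′ ⊆ walkVertices w × walkLength w′ ≡ walkLength w
  reversal R-sym ε = ε , (λ z∈ → z∈) , refl
  reversal R-sym (e ◅ w) = w′ ◅◅ (R-sym e ◅ ε) , ⊆w , length≡
    where
    w′ = proj₁ (reversal R-sym w)
    ⊆w : walkVertices (w′ ◅◅ (R-sym e ◅ ε)) ⊆ walkVertices (e ◅ w)
    ⊆w z∈ with ∈-◅◅⁻ w′ (R-sym e ◅ ε) z∈
    ... | inj₁ z∈w′               = there (proj₁ (proj₂ (reversal R-sym w)) z∈w′)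
    ... | inj₂ (here refl)        = there (start∈ w)
    ... | inj₂ (there (here z≡u)) = here z≡u
    length≡ : walkLength (w′ ◅◅ (R-sym e ◅ ε)) ≡ suc (walkLength w)
    length≡ = trans (walkLength-◅◅ w′ _)
                (trans (ℕ.+-comm _ 1) (cong suc (proj₂ (proj₂ (reversal R-sym w)))))

  -- Cut the walk after its last visit to u; since u ≢ x, the next vertex exists and is a neighbour
  -- of u.
  lastVisit : ∀ u {z x} (w : Star R z x) → u ≢ x → ¬ u ∈ₗ walkVertices w ⊎
              (∃ λ p → R u p × ∃ λ (w′ : Star R p x) →
               ¬ u ∈ₗ walkVertices w′ × walkVertices w′ ⊆ walkVertices w)
  lastVisit u ε u≢x = inj₁ λ where (here refl) → u≢x refl
  lastVisit u {z} (e ◅ w) u≢x with lastVisit u w u≢x | u Fin.≟ z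
  ... | inj₂ (p , e′ , w′ , u∉w′ , w′⊆w) | _ = inj₂ (p , e′ , w′ , u∉w′ , there ∘ w′⊆w)
  ... | inj₁ u∉w | yes refl = inj₂ (_ , e , w , u∉w , there)
  ... | inj₁ u∉w | no  u≢z  = inj₁ λ where
    (here u≡z)  → u≢z u≡z
    (there u∈w) → u∉w u∈w

  simpleSuffix : ∀ {x v z} (w : Star R x v) → Unique (walkVertices w) → z ∈ₗ walkVertices w →
                 ∃ λ (w′ : Star R z v) → Unique (walkVertices w′) × walkVertices w′ ⊆ walkVertices w
  simpleSuffix ε       s (here refl) = ε , s , λ z∈ → z∈
  simpleSuffix (e ◅ w) s (here refl) = e ◅ w , s , λ z∈ → z∈
  simpleSuffix (e ◅ w) (_ ∷ s) (there z∈) =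
    let w′ , s′ , w′⊆w = simpleSuffix w s z∈ in w′ , s′ , there ∘ w′⊆w

  suffixes-nested : ∀ {m v x y} (w : Star R m v) → Unique (walkVertices w) →
                    x ∈ₗ walkVertices w → y ∈ₗ walkVertices w →
                    (∃ λ (w′ : Star R x v) → Unique (walkVertices w′) × y ∈ₗ walkVertices w′) ⊎
                    (∃ λ (w′ : Star R y v) → Unique (walkVertices w′) × x ∈ₗ walkVertices w′)
  suffixes-nested ε       s (here refl) y∈ = inj₁ (ε , s , y∈)
  suffixes-nested (e ◅ w) s (here refl) y∈ = inj₁ (e ◅ w , s , y∈)
  suffixes-nested (e ◅ w) s x∈@(there _) (here refl) = inj₂ (e ◅ w , s , x∈)
  suffixes-nested (e ◅ w) (_ ∷ s) (there x∈) (there y∈) = suffixes-nested w s x∈ y∈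

  simplify : ∀ {u v} (w : Star R u v) → ∃ λ (w′ : Star R u v) →
             Unique (walkVertices w′) × walkVertices w′ ⊆ walkVertices w
  simplify ε = ε , [] ∷ [] , λ z∈ → z∈
  simplify {u} (e ◅ w) with simplify w
  ... | w′ , s , w′⊆w with Any.any? (u Fin.≟_) (walkVertices w′)
  ...   | yes u∈ = let w″ , s″ , w″⊆w′ = simpleSuffix w′ s u∈ in w″ , s″ , there ∘ w′⊆w ∘ w″⊆w′
  ...   | no  u∉ = e ◅ w′ , ¬Any⇒All¬ _ u∉ ∷ s , λ where
    (here eq)  → here eq
    (there z∈) → there (w′⊆w z∈)

-- Laminar families

-- A scan of all elements keeps the best one so far. Totality is asked on `P` alone, since a forest
-- order is total only on chains; the reversed order yields topmost nodes.
minimum : ∀ {n} {P : Fin n → Set} {_⊑_ : Rel (Fin n) 0ℓ} → (∀ x → Dec (P x)) →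
          Transitive _⊑_ → (∀ {x y} → P x → P y → x ⊑ y ⊎ y ⊑ x) →
          ∃ P → ∃ λ y → P y × (∀ {z} → P z → y ⊑ z)
minimum {n} {P} {_⊑_} P? ⊑-trans total (x , Px) =
  let y , Py , _ , y⊑ = among (allFin n) in y , Py , λ {z} → All.lookup y⊑ (∈-allFin z)
  where
  ⊑-refl : ∀ {z} → P z → z ⊑ z
  ⊑-refl Pz with total Pz Pz
  ... | inj₁ z⊑z = z⊑z
  ... | inj₂ z⊑z = z⊑z
  among : ∀ zs → ∃ λ y → P y × y ⊑ x × All (λ z → P z → y ⊑ z) zs
  among [] = x , Px , ⊑-refl Px , []
  among (z ∷ zs) with among zs | P? z
  ... | y , Py , y⊑x , y⊑zs | no ¬Pz = y , Py , y⊑x , (λ Pz → contradiction Pz ¬Pz) ∷ y⊑zs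
  ... | y , Py , y⊑x , y⊑zs | yes Pz with total Py Pz
  ...   | inj₁ y⊑z = y , Py , y⊑x , (λ _ → y⊑z) ∷ y⊑zs
  ...   | inj₂ z⊑y = z , Pz , ⊑-trans z⊑y y⊑x , ⊑-refl ∷ All.map (⊑-trans z⊑y ∘_) y⊑zs

module Forest {n} {_≼_ : Rel (Fin n) 0ℓ} (_≼?_ : Decidable _≼_)
              (≼-refl : Reflexive _≼_) (≼-trans : Transitive _≼_)
              (≼-comparable : ∀ {m x y} → m ≼ x → m ≼ y → x ≼ y ⊎ y ≼ x) where

  Marked : List (Fin n) → Fin n → Set
  Marked ms x = Any (_≼ x) ms

  marked? : ∀ ms x → Dec (Marked ms x)
  marked? ms x = Any.any? (_≼? x) ms

  infix 4 _≲[_]_ _≈[_]_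

  -- The laminar family is never built as sets: a node stands for the set of marks below it, this
  -- preorder is inclusion, and the members are the classes of `_≈[_]_`.
  _≲[_]_ : Fin n → List (Fin n) → Fin n → Set
  x ≲[ ms ] y = All (λ m → m ≼ x → m ≼ y) ms

  _≈[_]_ : Fin n → List (Fin n) → Fin n → Set
  x ≈[ ms ] y = x ≲[ ms ] y × y ≲[ ms ] x

  ≲? : ∀ ms x y → Dec (x ≲[ ms ] y)
  ≲? ms x y = All.all? (λ m → (m ≼? x) →-dec (m ≼? y)) ms

  ≲-refl : ∀ {ms x} → x ≲[ ms ] x
  ≲-refl = All.tabulate λ _ m≼x → m≼x

  ≲-trans : ∀ {ms x y z} → x ≲[ ms ] y → y ≲[ ms ] z → x ≲[ ms ] z
  ≲-trans x≲y y≲z = All.zipWith (λ (f , g) → g ∘ f) (x≲y , y≲z)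

  ≈-trans : ∀ {ms x y z} → x ≈[ ms ] y → y ≈[ ms ] z → x ≈[ ms ] z
  ≈-trans (x≲y , y≲x) (y≲z , z≲y) = ≲-trans x≲y y≲z , ≲-trans z≲y y≲x

  ≼⇒≲ : ∀ {ms x y} → x ≼ y → x ≲[ ms ] y
  ≼⇒≲ x≼y = All.tabulate λ _ m≼x → ≼-trans m≼x x≼y

  marked-mono : ∀ {ms x y} → Marked ms x → x ≲[ ms ] y → Marked ms y
  marked-mono (here m≼x)  (f ∷ _) = here (f m≼x)
  marked-mono (there mx) (_ ∷ fs) = there (marked-mono mx fs)

  -- Any mark below x is also below y, and the nodes above one mark form a chain.
  ≲-comparable : ∀ {ms x y} → Marked ms x → x ≲[ ms ] y → x ≼ y ⊎ y ≼ x
  ≲-comparable mx x≲y with All.lookupAny x≲y mx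
  ... | f , m≼x = ≼-comparable m≼x (f m≼x)

  -- Adding a mark m splits at most one class of nodes: that of the lowest node q
  -- above m with an old mark below it.  Hence m, q, and a node z of the class
  -- of q that is not above m represent all the new classes.
  representatives : ∀ ms → ∃ λ (xs : List (Fin n)) → length xs ≤ 3 * length ms ×
                    (∀ s → Marked ms s → ∃ λ x → x ∈ₗ xs × x ≈[ ms ] s)
  representatives [] = [] , z≤n , λ _ ()
  representatives (m ∷ ms)
    with representatives ms | any? (λ y → (m ≼? y) ×-dec marked? ms y)
  -- No node above m has an old mark below it, so the only new class is that of m as sole mark.
  ... | xs , |xs|≤ , rep | no none = m ∷ xs , |m∷xs|≤ , rep′
    where
    |m∷xs|≤ : suc (length xs) ≤ 3 * suc (length ms)
    |m∷xs|≤ = ℕ.≤-trans (s≤s (ℕ.≤-trans |xs|≤ (ℕ.m≤n+m _ 2)))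
                        (ℕ.≤-reflexive (sym (ℕ.*-suc 3 (length ms))))
    rep′ : ∀ s → Marked (m ∷ ms) s → ∃ λ x → x ∈ₗ m ∷ xs × x ≈[ m ∷ ms ] s
    rep′ s h with m ≼? s | marked? ms s
    ... | yes m≼s | yes hs = contradiction (s , m≼s , hs) none
    ... | no  m⋠s | no ¬hs = case h of λ where
      (here m≼s) → contradiction m≼s m⋠s
      (there hs) → contradiction hs ¬hs
    ... | yes m≼s | no ¬hs = m , here refl , ≼⇒≲ m≼s ,
      (λ _ → ≼-refl) ∷ All.map (λ m′⋠s m′≼s → contradiction m′≼s m′⋠s) (¬Any⇒All¬ ms ¬hs)
    ... | no  m⋠s | yes hs with rep s hs
    ...   | x , x∈ , x≲s , s≲x = x , there x∈ ,
      (λ m≼x → contradiction (x , m≼x , marked-mono hs s≲x) none) ∷ x≲s ,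
      (λ m≼s → contradiction m≼s m⋠s) ∷ s≲x
  representatives (m ∷ ms) | xs , |xs|≤ , rep | yes above
    with minimum (λ y → (m ≼? y) ×-dec marked? ms y) ≼-trans
                 (λ (m≼x , _) (m≼y , _) → ≼-comparable m≼x m≼y) above
  ... | q , (m≼q , hq) , q-least = m ∷ q ∷ z ∷ xs , |m∷q∷z∷xs|≤ , rep′
    where
    splits? : Dec (∃ λ y → (y ≲[ ms ] q × q ≲[ ms ] y) × ¬ m ≼ y)
    splits? = any? λ y → (≲? ms y q ×-dec ≲? ms q y) ×-dec ¬? (m ≼? y)
    z : Fin n
    z with splits?
    ... | yes (y , _) = y
    -- A default: `z` serves as a representative only where `z-splits` has a witness.
    ... | no  _       = m
    z-splits : ∀ {y} → y ≈[ ms ] q → ¬ m ≼ y → z ≈[ ms ] q × ¬ m ≼ z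
    z-splits y≈q m⋠y with splits?
    ... | yes (_ , p) = p
    ... | no  none    = contradiction (_ , y≈q , m⋠y) none
    |m∷q∷z∷xs|≤ : 3 + length xs ≤ 3 * suc (length ms)
    |m∷q∷z∷xs|≤ = ℕ.≤-trans (ℕ.+-monoʳ-≤ 3 |xs|≤)
                            (ℕ.≤-reflexive (sym (ℕ.*-suc 3 (length ms))))
    extend : ∀ {x y} → (m ≼ x → m ≼ y) → (m ≼ y → m ≼ x) →
             x ≈[ ms ] y → x ≈[ m ∷ ms ] y
    extend f g (x≲y , y≲x) = f ∷ x≲y , g ∷ y≲x
    rep′ : ∀ s → Marked (m ∷ ms) s → ∃ λ x → x ∈ₗ m ∷ q ∷ z ∷ xs × x ≈[ m ∷ ms ] s
    rep′ s h with marked? ms s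
    ... | no ¬hs = m , here refl , ≼⇒≲ m≼s ,
      (λ _ → ≼-refl) ∷ All.map (λ m′⋠s m′≼s → contradiction m′≼s m′⋠s) (¬Any⇒All¬ ms ¬hs)
      where
      m≼s : m ≼ s
      m≼s = case h of λ where
        (here m≼s) → m≼s
        (there hs) → contradiction hs ¬hs
    ... | yes hs with rep s hs | m ≼? s
    ...   | x , x∈ , x≲s , s≲x | yes m≼s with ≲? ms s q
    ...     | yes s≲q = q , there (here refl) ,
      extend (λ _ → m≼s) (λ _ → m≼q) (≼⇒≲ (q-least (m≼s , hs)) , s≲q)
    -- Now s, and with it x, has more old marks than q, so x is not below q; being comparable to q,
    -- it is above q and hence above m.
    ...     | no  s≴q = x , there (there (there x∈)) ,
      extend (λ _ → m≼s) (λ _ → m≼x) (x≲s , s≲x)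
      where
      q≲x : q ≲[ ms ] x
      q≲x = ≲-trans (≼⇒≲ (q-least (m≼s , hs))) s≲x
      m≼x : m ≼ x
      m≼x with ≲-comparable hq q≲x
      ... | inj₁ q≼x = ≼-trans m≼q q≼x
      ... | inj₂ x≼q = contradiction (≲-trans s≲x (≼⇒≲ x≼q)) s≴q
    rep′ s h | yes hs | x , x∈ , x≲s , s≲x | no m⋠s with m ≼? x
    ... | no  m⋠x = x , there (there (there x∈)) ,
      extend (λ m≼x → contradiction m≼x m⋠x) (λ m≼s → contradiction m≼s m⋠s) (x≲s , s≲x)
    -- By minimality q ≼ x, so s has all old marks of q. As s is not above m, it is not above q; so
    -- s ≼ q, and s is in the old class of q but not above m, like z.
    ... | yes m≼x = z , there (there (here refl)) ,
      extend (λ m≼z → contradiction m≼z (proj₂ zq)) (λ m≼s → contradiction m≼s m⋠s)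
             (≈-trans (proj₁ zq) (q≲s , s≲q))
      where
      q≲s : q ≲[ ms ] s
      q≲s = ≲-trans (≼⇒≲ (q-least (m≼x , marked-mono hs s≲x))) x≲s
      s≲q : s ≲[ ms ] q
      s≲q with ≲-comparable hq q≲s
      ... | inj₁ q≼s = contradiction (≼-trans m≼q q≼s) m⋠s
      ... | inj₂ s≼q = ≼⇒≲ s≼q
      zq : z ≈[ ms ] q × ¬ m ≼ z
      zq = z-splits (s≲q , q≲s) m⋠s

-- Rooted trees

module RootedTree {n} (T : Graph n) (isTree : IsTree T) (root : Fin n) where

  open Graph T
  open IsTree isTree

  -- A walk from p to s that avoids u, made simple, would close up to a cycle through u.
  cutVertex : ∀ {u p s} → Adj u p → Adj u s → p ≢ s → (w : Walk T p s) → u ∈ₗ walkVertices w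
  cutVertex {u} {p} {s} up us p≢s w with Any.any? (u Fin.≟_) (walkVertices w) | simplify w
  ... | yes u∈w | _ = u∈w
  ... | no  u∉w | ε , _ , _ = contradiction refl p≢s
  ... | no  u∉w | w′@(_ ◅ _) , simple , w′⊆w = contradiction cycle acyclic
    where
    cycle : Cycle T
    cycle = record
      { path    = mkPath (up ◅ w′) (¬Any⇒All¬ _ (u∉w ∘ w′⊆w) ∷ simple)
      ; long    = s≤s (s≤s z≤n)
      ; closing = symmetric us
      }

  -- After its last visit to u, `w′` must step to the neighbour that the simple walk takes:
  -- otherwise the rest of `w′` and the reversed simple walk would join two neighbours of u without
  -- meeting u, against `cutVertex`. Then induct from that neighbour.
  simple⊆ : ∀ {u x} (w : Walk T u x) → Unique (walkVertices w) → (w′ : Walk T u x) →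
            walkVertices w ⊆ walkVertices w′
  simple⊆ ε       _       w′ (here refl) = start∈ w′
  simple⊆ (_ ◅ _) _       w′ (here refl) = start∈ w′
  simple⊆ {u} (_◅_ {j = s} us w) (u∉ ∷ simple) w′ (there z∈)
    with lastVisit u w′ (λ where refl → All¬⇒¬Any u∉ (end∈ w))
  ... | inj₁ u∉w′ = contradiction (start∈ w′) u∉w′
  ... | inj₂ (p , up , w″ , u∉w″ , w″⊆w′) with p Fin.≟ s
  ...   | yes refl = w″⊆w′ (simple⊆ w simple w″ z∈)
  ...   | no  p≢s  = contradiction (cutVertex up us p≢s (w″ ◅◅ w⁻¹)) λ u∈ →
      case ∈-◅◅⁻ w″ w⁻¹ u∈ of λ where
        (inj₁ u∈w″)  → u∉w″ u∈w″
        (inj₂ u∈w⁻¹) → All¬⇒¬Any u∉ (proj₁ (proj₂ (reversal symmetric w)) u∈w⁻¹)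
      where w⁻¹ = proj₁ (reversal symmetric w)

  toRoot : ∀ x → Path T x root
  toRoot x = connected x root

  infix 4 _≼_ _≼?_

  _≼_ : Rel (Fin n) 0ℓ
  x ≼ y = y ∈ₗ pathVertices (toRoot x)

  _≼?_ : Decidable _≼_
  x ≼? y = Any.any? (y Fin.≟_) (pathVertices (toRoot x))

  ≼⇒∈ : ∀ {x y} → x ≼ y → (w : Walk T x root) → y ∈ₗ walkVertices w
  ≼⇒∈ {x} x≼y w = simple⊆ (Path.walk (toRoot x)) (Path.simple (toRoot x)) w x≼y

  ≼-refl : Reflexive _≼_
  ≼-refl {x} = start∈ (Path.walk (toRoot x))

  ≼-root : ∀ {x} → x ≼ root
  ≼-root {x} = end∈ (Path.walk (toRoot x))

  ≼-trans : Transitive _≼_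
  ≼-trans {x} {y} {z} x≼y y≼z with splitAt (Path.walk (toRoot x)) x≼y
  ... | w₁ , w₂ , eq = subst (λ w → z ∈ₗ walkVertices w) (sym eq) (∈-◅◅⁺ʳ w₁ w₂ (≼⇒∈ y≼z w₂))

  ≼-comparable : ∀ {m x y} → m ≼ x → m ≼ y → x ≼ y ⊎ y ≼ x
  ≼-comparable {m} {x} {y} m≼x m≼y
    with suffixes-nested (Path.walk (toRoot m)) (Path.simple (toRoot m)) m≼x m≼y
  ... | inj₁ (w , s , y∈w) = inj₁ (simple⊆ w s (Path.walk (toRoot x)) y∈w)
  ... | inj₂ (w , s , x∈w) = inj₂ (simple⊆ w s (Path.walk (toRoot y)) x∈w)

  -- A walk from x to the root passes y, the rest from y passes x, and so on; as long as x and y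
  -- differ, the rests get strictly shorter.
  ≼-antisym : ∀ {x y} → x ≼ y → y ≼ x → x ≡ y
  ≼-antisym {x} x≼y y≼x = descend _ x≼y y≼x (Path.walk (toRoot x)) ℕ.≤-refl
    where
    descend : ∀ d {x y} → x ≼ y → y ≼ x → (w : Walk T x root) → walkLength w ≤ d → x ≡ y
    descend d {x} {y} x≼y y≼x w w≤d with splitAt w (≼⇒∈ x≼y w) | d
    ... | ε       , _  , refl | _     = refl
    ... | _ ◅ w₁  , w₂ , refl | suc d =
      sym (descend d y≼x x≼y w₂ (ℕ.≤-trans
        (ℕ.≤-trans (ℕ.m≤n+m _ _) (ℕ.≤-reflexive (sym (walkLength-◅◅ w₁ w₂)))) (ℕ.≤-pred w≤d)))

  -- If y is off the path from x to the root, then y followed by this path is the path from y, and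
  -- it passes x.
  edge-comparable : ∀ {x y} → Adj x y → x ≼ y ⊎ y ≼ x
  edge-comparable {x} {y} xy with x ≼? y
  ... | yes x≼y = inj₁ x≼y
  ... | no  x⋠y = inj₂ (simple⊆ (symmetric xy ◅ Path.walk (toRoot x))
                                (¬Any⇒All¬ _ x⋠y ∷ Path.simple (toRoot x))
                                (Path.walk (toRoot y)) (there ≼-refl))

  -- Separation and gates

  Separates : Fin n → Fin n → Fin n → Set
  Separates t s m = (w : Walk T s m) → t ∈ₗ walkVertices w

  separates-sym : ∀ {t s m} → Separates t s m → Separates t m s
  separates-sym sep w =
    let w⁻¹ , w⁻¹⊆w , _ = reversal symmetric w in w⁻¹⊆w (sep w⁻¹)

  -- Continue a walk from s to m up to the root: it meets t, but not on the path from m.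
  leaving-separates : ∀ {t s m} → s ≼ t → ¬ m ≼ t → Separates t s m
  leaving-separates {m = m} s≼t m⋠t w
    with ∈-◅◅⁻ w (Path.walk (toRoot m)) (≼⇒∈ s≼t (w ◅◅ Path.walk (toRoot m)))
  ... | inj₁ t∈w = t∈w
  ... | inj₂ m≼t = contradiction m≼t m⋠t

  -- Neighbours on the walk are comparable, so when s is prepended, the peak of the rest or s
  -- itself, whichever is higher, lies above both ends.
  walk-peak : ∀ {s m} (w : Walk T s m) → ∃ λ c → c ∈ₗ walkVertices w × s ≼ c × m ≼ c
  walk-peak {s} ε = s , here refl , ≼-refl , ≼-refl
  walk-peak {s} (sy ◅ w) with walk-peak w
  ... | c , c∈w , y≼c , m≼c with edge-comparable sy
  ...   | inj₁ s≼y = c , there c∈w , ≼-trans s≼y y≼c , m≼c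
  ...   | inj₂ y≼s with ≼-comparable y≼c y≼s
  ...     | inj₁ c≼s = s , here refl , ≼-refl , ≼-trans m≼c c≼s
  ...     | inj₂ s≼c = c , there c∈w , s≼c , m≼c

  -- The walk contains a common ancestor c of s and m, and q ≼ c. Either c is q, or c is not below q
  -- and the part from s to c leaves the subtree of q through q.
  lca-separates : ∀ {q s m} → s ≼ q → (∀ {c} → s ≼ c → m ≼ c → q ≼ c) → Separates q s m
  lca-separates {q} {s} {m} s≼q least w with walk-peak w
  ... | c , c∈w , s≼c , m≼c with c ≼? q
  ...   | yes c≼q = subst (_∈ₗ walkVertices w) (≼-antisym c≼q (least s≼c m≼c)) c∈w
  ...   | no  c⋠q with splitAt w c∈w
  ...     | w₁ , w₂ , refl = ∈-◅◅⁺ˡ w₁ w₂ (leaving-separates s≼q c⋠q w₁)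

  open Forest _≼?_ ≼-refl ≼-trans ≼-comparable

  -- `isBelow` is part of the data because decoding has to pick the gate of a mark without knowing
  -- s.
  record Gates : Set where
    field
      lower upper : Fin n
      isBelow     : Fin n → Bool

    gate : Fin n → Fin n
    gate m = if isBelow m then lower else upper

  open Gates using (gate)

  -- The nodes with exactly the marks of x below them form a chain.  Its lowest
  -- node is the gate to these marks, its topmost node the gate to all others.
  classGates : ∀ ms x → ∃ λ g → Marked ms x → ∀ {s s′} →
               s ≼ s′ → (∀ {c} → s ≼ c → Marked ms c → s′ ≼ c) → x ≈[ ms ] s′ →
               ∀ {m} → m ∈ₗ ms → Separates (gate g m) s m
  classGates ms x with marked? ms x
  ... | no ¬hx = record { lower = x ; upper = x ; isBelow = λ _ → true } , λ hx → contradiction hx ¬hx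
  ... | yes hx = record { lower = q ; upper = u ; isBelow = λ m → does (m ≼? q) } , separates
    where
    InClass : Fin n → Set
    InClass y = x ≲[ ms ] y × y ≲[ ms ] x
    inClass? : ∀ y → Dec (InClass y)
    inClass? y = ≲? ms x y ×-dec ≲? ms y x
    chain : ∀ {y z} → InClass y → InClass z → y ≼ z ⊎ z ≼ y
    chain (x≲y , y≲x) (x≲z , _) = ≲-comparable (marked-mono hx x≲y) (≲-trans y≲x x≲z)
    lowest = minimum inClass? ≼-trans chain (x , ≲-refl , ≲-refl)
    topmost = minimum {_⊑_ = λ y z → z ≼ y} inClass? (λ y≼x z≼y → ≼-trans z≼y y≼x)
                (λ y z → chain z y) (x , ≲-refl , ≲-refl)
    q = proj₁ lowest
    u = proj₁ topmost
    x≲q = proj₁ (proj₁ (proj₂ lowest))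
    u≲q = ≲-trans (proj₂ (proj₁ (proj₂ topmost))) x≲q
    separates : Marked ms x → ∀ {s s′} → s ≼ s′ → (∀ {c} → s ≼ c → Marked ms c → s′ ≼ c) →
                x ≈[ ms ] s′ → ∀ {m} → m ∈ₗ ms →
                Separates (if does (m ≼? q) then q else u) s m
    separates _ {s} {s′} s≼s′ least x≈s′ {m} m∈ with m ≼? q
    -- The topmost node u has the same marks as q, so m is not below u, whereas s is.
    ... | no m⋠q = leaving-separates (≼-trans s≼s′ (proj₂ (proj₂ topmost) x≈s′))
                                     (m⋠q ∘ All.lookup u≲q m∈)
    ... | yes m≼q with s ≼? q
    ...   | no  s⋠q = separates-sym (leaving-separates m≼q s⋠q)
    -- A common ancestor of s and m is a marked ancestor of s, hence above s′, which is above q.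
    ...   | yes s≼q = lca-separates s≼q λ s≼c m≼c →
      ≼-trans (proj₂ (proj₂ lowest) x≈s′) (least s≼c (lose m∈ m≼c))

  -- Each representative contributes one pair. The mark `m₀` makes the root a marked ancestor of s,
  -- so there is a lowest marked ancestor s′; the pair for the class of s′ serves s.
  gates : ∀ ms → ∃ λ (gs : List Gates) → length gs ≤ 3 * length ms ×
          (∀ s {m₀} → m₀ ∈ₗ ms → ∃ λ g → g ∈ₗ gs × (∀ {m} → m ∈ₗ ms → Separates (gate g m) s m))
  gates ms with representatives ms
  ... | xs , |xs|≤ , rep =
    List.map classGate xs , subst (_≤ 3 * length ms) (sym (length-map classGate xs)) |xs|≤ , separates
    where
    classGate : Fin n → Gates
    classGate = proj₁ ∘ classGates ms
    separates : ∀ s {m₀} → m₀ ∈ₗ ms → ∃ λ g → g ∈ₗ List.map classGate xs ×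
                (∀ {m} → m ∈ₗ ms → Separates (gate g m) s m)
    separates s m₀∈
      with minimum (λ y → (s ≼? y) ×-dec marked? ms y) ≼-trans
                   (λ (s≼x , _) (s≼y , _) → ≼-comparable s≼x s≼y)
                   (root , ≼-root , lose m₀∈ ≼-root)
    ... | s′ , (s≼s′ , hs′) , least with rep s′ hs′
    ...   | x , x∈ , x≈s′ = classGate x , ∈-map⁺ classGate x∈ ,
      proj₂ (classGates ms x) (marked-mono hs′ (proj₂ x≈s′)) s≼s′ (λ s≼c hc → least (s≼c , hc)) x≈s′

-- Distances through a bag

-- A minimum cut off at b: the value b also stands for the absence of smaller witnesses.
leastUpTo : ∀ {P : ℕ → Set} → (∀ d → Dec (P d)) → ∀ b →
            ∃ λ d → d ≤ b × (∀ {e} → P e → d ≤ e) × (d ≡ b ⊎ P d)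
leastUpTo P? b with leastWitness P? b
... | inj₂ none = b , ℕ.≤-refl , (λ Pe → ℕ.≮⇒≥ λ e<b → none e<b Pe) , inj₁ refl
... | inj₁ (d , Pd , minimal) with d ℕ.≤? b
...   | yes d≤b = d , d≤b , (λ Pe → ℕ.≮⇒≥ λ e<d → minimal e<d Pe) , inj₂ Pd
...   | no  d≰b = b , ℕ.≤-refl ,
  (λ Pe → ℕ.≮⇒≥ λ e<b → minimal (ℕ.<-trans e<b (ℕ.≰⇒> d≰b)) Pe) , inj₁ refl

cap-≡∞ : ∀ {r d} → r < d → cap r [ d ] ≡ ⊤⁺
cap-≡∞ {r} {d} r<d with d ℕ.≤? r
... | yes d≤r = contradiction d≤r (ℕ.<⇒≱ r<d)
... | no  _   = refl

module Representation {n} (G : Graph n) (R : TreeRepresentation G)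
                      {ℓ} (R≤ℓ : TreeRepresentation.repLength R ≤⁺ [ ℓ ]) where

  open Graph G
  open TreeRepresentation R

  node : Fin n → Fin nodes
  node v = proj₁ (IsSubtree.nonempty (isSubtree v))

  node∈ : ∀ v → node v ∈ subtree v
  node∈ v = proj₂ (IsSubtree.nonempty (isSubtree v))

  -- Consecutive vertices have subtrees with a common node, so a walk in `G` lifts to the tree
  -- inside the subtrees of its vertices. Hence it meets the bag of every node that its lift must
  -- visit.
  trace : ∀ {u v} (w : Walk G u v) {s t} → s ∈ subtree u → t ∈ subtree v →
          ∃ λ (w′ : Walk tree s t) →
          ∀ {x} → x ∈ₗ walkVertices w′ → ∃ λ b → b ∈ₗ walkVertices w × x ∈ subtree b
  trace {u} ε s∈ t∈ = let p , p⊆ = IsSubtree.connected (isSubtree u) s∈ t∈ in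
    Path.walk p , λ x∈ → u , here refl , All.lookup p⊆ x∈
  trace {u} (e ◅ w) s∈ t∈ =
    let y , y∈u , y∈v = share e
        p , p⊆  = IsSubtree.connected (isSubtree u) s∈ y∈u
        w′ , w′⊆ = trace w y∈v t∈
    in Path.walk p ◅◅ w′ , λ x∈ → case ∈-◅◅⁻ (Path.walk p) w′ x∈ of λ where
         (inj₁ x∈p)  → u , here refl , All.lookup p⊆ x∈p
         (inj₂ x∈w′) → let b , b∈w , x∈b = w′⊆ x∈w′ in b , there b∈w , x∈b

  bag-dist : ∀ {t u v} → t ∈ subtree u → t ∈ subtree v → dist G u v ≤⁺ [ ℓ ]
  bag-dist {t} {u} {v} t∈u t∈v = ≤∞-trans (≤∞-trans
    (All.lookup (Extrema.xs≤max ℕ∞-totalOrder [ 0 ] (List.cartesianProductWith (dist G) (bag t) (bag t)))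
      (∈-cartesianProductWith⁺ (dist G) (inBag t∈u) (inBag t∈v)))
    (All.lookup (Extrema.xs≤max ℕ∞-totalOrder [ 0 ] (List.map bagDiameter (allFin nodes)))
      (∈-map⁺ bagDiameter (∈-allFin t)))) R≤ℓ
    where
    ≤∞-trans : Transitive _≤⁺_
    ≤∞-trans = ≤⁺-trans ℕ.≤-trans
    inBag : ∀ {v} → t ∈ subtree v → v ∈ₗ bag t
    inBag {v} t∈v = ∈-filter⁺ (λ v → t ∈? subtree v) (∈-allFin v) t∈v

  bag-walk : ∀ {t u v} → t ∈ subtree u → t ∈ subtree v → ∃ λ (w : Walk G u v) → walkLength w ≤ ℓ
  bag-walk {t} {u} {v} t∈u t∈v with dist G u v | dist-isDistance G u v | bag-dist t∈u t∈v
  ... | [ d ] | (p , refl) , _ | [ d≤ℓ ] = Path.walk p , d≤ℓ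

  WalkToBag : Fin nodes → Fin n → ℕ → Set
  WalkToBag t u d = ∃ λ b → t ∈ subtree b × WalkOfLength {G = G} u b d

  -- The cut-off at r + 1 leaves r + 2 possible values and is harmless, as `cap r` sends everything
  -- beyond r to infinity.
  nearestInBag : ∀ r t u → ∃ λ d → d ≤ suc r × (∀ {e} → WalkToBag t u e → d ≤ e) ×
                                   (d ≡ suc r ⊎ WalkToBag t u d)
  nearestInBag r t u =
    leastUpTo (λ d → any? λ b → (t ∈? subtree b) ×-dec walkOfLength? {G = G} u b d) (suc r)

  bagDist : ℕ → Fin nodes → Fin n → ℕ
  bagDist r t u = proj₁ (nearestInBag r t u)

  -- As d and e are at most r, neither is a cut-off value; walks of these lengths lead to the bag,
  -- and crossing it costs at most ℓ.
  throughBag : ∀ {r t u v d e} → bagDist r t u ≡ d → bagDist r t v ≡ e → d ≤ r → e ≤ r →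
               ∃ λ (w : Walk G u v) → walkLength w ≤ d + e + ℓ
  throughBag {r} {t} {u} {v} refl refl d≤r e≤r
    with proj₂ (proj₂ (proj₂ (nearestInBag r t u))) | proj₂ (proj₂ (proj₂ (nearestInBag r t v)))
  ... | inj₁ eq | _       = contradiction (ℕ.≤-trans (ℕ.≤-reflexive (sym eq)) d≤r) ℕ.1+n≰n
  ... | inj₂ _  | inj₁ eq = contradiction (ℕ.≤-trans (ℕ.≤-reflexive (sym eq)) e≤r) ℕ.1+n≰n
  ... | inj₂ (b , t∈b , w₁ , |w₁|) | inj₂ (b′ , t∈b′ , w₂ , |w₂|)
    with bag-walk t∈b t∈b′ | reversal symmetric w₂
  ...   | w , |w|≤ℓ | w₂⁻¹ , _ , |w₂⁻¹| = w₁ ◅◅ w ◅◅ w₂⁻¹ , (begin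
    walkLength (w₁ ◅◅ w ◅◅ w₂⁻¹)                  ≡⟨ walkLength-◅◅ w₁ _ ⟩
    walkLength w₁ + walkLength (w ◅◅ w₂⁻¹)        ≡⟨ cong₂ _+_ |w₁| (walkLength-◅◅ w _) ⟩
    d + (walkLength w + walkLength w₂⁻¹)          ≡⟨ cong (λ x → d + (walkLength w + x)) (trans |w₂⁻¹| |w₂|) ⟩
    d + (walkLength w + e)                        ≤⟨ ℕ.+-monoʳ-≤ d (ℕ.+-monoˡ-≤ e |w|≤ℓ) ⟩
    d + (ℓ + e)                                   ≡⟨ cong (d +_) (ℕ.+-comm ℓ e) ⟩
    d + (e + ℓ)                                   ≡⟨ sym (ℕ.+-assoc d e ℓ) ⟩
    d + e + ℓ                                     ∎)
    where
    open ℕ.≤-Reasoning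
    d = bagDist r t u
    e = bagDist r t v

  module _ {root : Fin nodes} where

    open RootedTree tree isTree root

    -- The lift of w to the tree visits t, so w meets the bag of t; cut there, its two parts bound
    -- the two distances. A cut-off only lowers them.
    bagDist-lower : ∀ {r t u v} → Separates t (node v) (node u) → (w : Walk G u v) →
                    bagDist r t u + bagDist r t v ≤ walkLength w
    bagDist-lower {r} {t} {u} {v} sep w with trace w (node∈ u) (node∈ v)
    ... | w′ , w′⊆ with w′⊆ (separates-sym sep w′)
    ...   | b , b∈w , t∈b with splitAt w b∈w
    ...     | w₁ , w₂ , refl with reversal symmetric w₂
    ...       | w₂⁻¹ , _ , |w₂⁻¹| = subst (bagDist r t u + bagDist r t v ≤_) (sym (walkLength-◅◅ w₁ w₂))
      (ℕ.+-mono-≤ (nearest u (b , t∈b , w₁ , refl)) (nearest v (b , t∈b , w₂⁻¹ , |w₂⁻¹|)))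
      where
      nearest : ∀ u {e} → WalkToBag t u e → bagDist r t u ≤ e
      nearest u = proj₁ (proj₂ (proj₂ (nearestInBag r t u)))

    -- Here j is the defect. If one of the two bag distances exceeds r, both sides are infinite by
    -- `bagDist-lower`, and j = 0 serves. Otherwise the distance lies between their sum and that sum
    -- plus ℓ.
    cap-dist : ∀ {r t u v} → Separates t (node v) (node u) → ∃ λ j → j < ℓ + 1 ×
               cap r (dist G u v) ≡ cap r [ bagDist r t u + bagDist r t v + j ]
    cap-dist {r} {t} {u} {v} sep = capped (dist G u v) (dist-isDistance G u v)
      where
      d = bagDist r t u
      e = bagDist r t v
      far : r < d + e → ∀ δ → IsDistance G u v δ → ∃ λ j → j < ℓ + 1 × cap r δ ≡ cap r [ d + e + j ]
      far r<d+e ⊤⁺ _ = 0 , ℕ.m≤n+m 1 ℓ , sym (cap-≡∞ (ℕ.≤-trans r<d+e (ℕ.m≤m+n _ 0)))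
      far r<d+e [ δ ] ((p , refl) , _) = 0 , ℕ.m≤n+m 1 ℓ ,
        trans (cap-≡∞ (ℕ.≤-trans r<d+e (bagDist-lower {r} sep (Path.walk p))))
              (sym (cap-≡∞ (ℕ.≤-trans r<d+e (ℕ.m≤m+n _ 0))))
      near : d ≤ r → e ≤ r → ∀ δ → IsDistance G u v δ →
             ∃ λ j → j < ℓ + 1 × cap r δ ≡ cap r [ d + e + j ]
      near d≤r e≤r δ isδ with throughBag {r} {t} refl refl d≤r e≤r | δ
      ... | w , _      | ⊤⁺    = contradiction (proj₁ (toPath w)) isδ
      -- The lower bound makes this subtraction exact, and the walk `w` keeps it at most ℓ.
      ... | w , |w|≤   | [ x ] = x ∸ (d + e) ,
        ℕ.≤-trans (s≤s (ℕ.m≤n+o⇒m∸n≤o x (d + e) x≤)) (ℕ.≤-reflexive (ℕ.+-comm 1 ℓ)) ,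
        cong (λ y → cap r [ y ]) (sym (ℕ.m+[n∸m]≡n (d+e≤ (proj₁ isδ))))
        where
        x≤ : x ≤ d + e + ℓ
        x≤ = ℕ.≤-trans (proj₂ isδ (proj₁ (toPath w))) (ℕ.≤-trans (proj₂ (toPath w)) |w|≤)
        d+e≤ : (∃ λ (p : Path G u v) → pathLength p ≡ x) → d + e ≤ x
        d+e≤ (p , refl) = bagDist-lower {r} sep (Path.walk p)
      capped : ∀ δ → IsDistance G u v δ → ∃ λ j → j < ℓ + 1 × cap r δ ≡ cap r [ d + e + j ]
      capped with d ℕ.≤? r | e ℕ.≤? r
      ... | yes d≤r | yes e≤r = near d≤r e≤r
      ... | no  d≰r | _       = far (ℕ.≤-trans (ℕ.≰⇒> d≰r) (ℕ.m≤m+n d e))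
      ... | yes _   | no e≰r  = far (ℕ.≤-trans (ℕ.≰⇒> e≰r) (ℕ.m≤n+m e d))

-- Counting

length-cartesianProductWith : ∀ {A B C : Set} (f : A → B → C) xs ys →
  length (List.cartesianProductWith f xs ys) ≡ length xs * length ys
length-cartesianProductWith f []       ys = refl
length-cartesianProductWith f (x ∷ xs) ys =
  trans (length-++ (List.map (f x) ys))
        (cong₂ _+_ (length-map (f x) ys) (length-cartesianProductWith f xs ys))

module _ {A : Set} {_≈_ : Rel A 0ℓ} (_≈?_ : Decidable _≈_)
         (≈-euclidean : ∀ {x y z} → x ≈ z → y ≈ z → x ≈ y) where

  deduplicate-distinct : ∀ xs → AllPairs (λ x y → ¬ x ≈ y) (List.deduplicate _≈?_ xs)
  deduplicate-distinct []       = []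
  deduplicate-distinct (x ∷ xs) =
    all-filter _ (List.deduplicate _≈?_ xs) ∷ AllPairs.filter⁺ _ (deduplicate-distinct xs)

  -- Send each entry to the index of a code that it matches. By the pigeonhole principle a longer
  -- list has two entries with one index, and `≈-euclidean` relates them.
  distinct-length : ∀ {xs} cs → AllPairs (λ x y → ¬ x ≈ y) xs →
                    All (λ x → Any (x ≈_) cs) xs → length xs ≤ length cs
  distinct-length {xs} cs distinct covered = ℕ.≮⇒≥ λ |cs|<|xs| →
    let i , j , i<j , eq = pigeonhole |cs|<|xs| code in
    separated distinct i<j (≈-euclidean (lookup-index (cover i))
      (subst (λ c → List.lookup xs j ≈ List.lookup cs c) (sym eq) (lookup-index (cover j))))
    where
    cover : ∀ i → Any (List.lookup xs i ≈_) cs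
    cover i = All.lookup covered (∈-lookup i)
    code : Fin (length xs) → Fin (length cs)
    code i = Any.index (cover i)
    separated : ∀ {xs i j} → AllPairs (λ x y → ¬ x ≈ y) xs → i Fin< j →
                ¬ List.lookup xs i ≈ List.lookup xs j
    separated {i = zero}  {suc j} (x≉ ∷ _) _         = All.lookup x≉ (∈-lookup j)
    separated {i = suc i} {suc j} (_ ∷ ps) (s≤s i<j) = separated ps i<j

profileCount-≤ : ∀ {n} {G : Graph n} {A : Subset n} {r} (cs : List (Profile A)) →
                 (∀ v → Any (profile r G A v ≈ₚ_) cs) → profileCount r G A ≤ length cs
profileCount-≤ {n} {G} {A} {r} cs covered =
  distinct-length _≈ₚ?_ (λ p q a a∈ → trans (p a a∈) (sym (q a a∈))) cs
    (deduplicate-distinct _≈ₚ?_ (λ p q a a∈ → trans (p a a∈) (sym (q a a∈))) profiles)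
    (All.deduplicate⁺ _≈ₚ?_ (All.filter⁺ _ (All.map⁺ {xs = allFin n} (All.tabulate λ {v} _ → covered v))))
  where
  profiles : List (Profile A)
  profiles = List.filter (λ p → ¬? (p ≈ₚ? ∞ₚ)) (List.map (profile r G A) (allFin n))

∣p∣>0⇒Nonempty : ∀ {n} (A : Subset n) → 0 < ∣ A ∣ → Nonempty A
∣p∣>0⇒Nonempty (inside  ∷ A) _     = zero , here
∣p∣>0⇒Nonempty (outside ∷ A) 0<∣A∣ =
  let a , a∈A = ∣p∣>0⇒Nonempty A 0<∣A∣ in suc a , there a∈A

elements : ∀ {n} → Subset n → List (Fin n)
elements []            = []
elements (outside ∷ A) = List.map suc (elements A)
elements (inside  ∷ A) = zero ∷ List.map suc (elements A)

length-elements : ∀ {n} (A : Subset n) → length (elements A) ≡ ∣ A ∣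
length-elements []            = refl
length-elements (outside ∷ A) = trans (length-map suc (elements A)) (length-elements A)
length-elements (inside  ∷ A) = cong suc (trans (length-map suc (elements A)) (length-elements A))

∈-elements : ∀ {n} {A : Subset n} {a} → a ∈ A → a ∈ₗ elements A
∈-elements {A = inside  ∷ A} here       = here refl
∈-elements {A = inside  ∷ A} (there a∈) = there (∈-map⁺ suc (∈-elements a∈))
∈-elements {A = outside ∷ A} (there a∈) = ∈-map⁺ suc (∈-elements a∈)

-- The functions A → {0, …, b − 1}, extended to all vertices by 0.
choices : ∀ {n} → Subset n → ℕ → List (Fin n → ℕ)
choices []            b = (λ ()) ∷ []
choices (outside ∷ A) b = List.map (0 Vector.∷_) (choices A b)
choices (inside  ∷ A) b = List.cartesianProductWith Vector._∷_ (List.upTo b) (choices A b)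

length-choices : ∀ {n} (A : Subset n) b → length (choices A b) ≡ b ^ ∣ A ∣
length-choices []            b = refl
length-choices (outside ∷ A) b = trans (length-map (0 Vector.∷_) (choices A b)) (length-choices A b)
length-choices (inside  ∷ A) b =
  trans (length-cartesianProductWith Vector._∷_ (List.upTo b) (choices A b))
        (cong₂ _*_ (length-upTo b) (length-choices A b))

-- Finite choice. The function is assembled along `A` exactly as `choices` lists it, since
-- membership in the list is up to propositional equality of functions.
choose : ∀ {n} (A : Subset n) {b} {P : Fin n → ℕ → Set} →
         (∀ a → a ∈ A → ∃ λ j → j < b × P a j) →
         ∃ λ f → f ∈ₗ choices A b × (∀ a → a ∈ A → P a (f a))
choose []            possible = (λ ()) , here refl , λ ()
choose (outside ∷ A) possible with choose A (λ a a∈ → possible (suc a) (there a∈))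
... | f , f∈ , Pf = 0 Vector.∷ f , ∈-map⁺ (0 Vector.∷_) f∈ , λ where (suc a) (there a∈) → Pf a a∈
choose (inside  ∷ A) possible
  with possible zero here | choose A (λ a a∈ → possible (suc a) (there a∈))
... | j , j<b , Pj | f , f∈ , Pf =
  j Vector.∷ f , ∈-cartesianProductWith⁺ Vector._∷_ (∈-upTo⁺ j<b) f∈ , λ where
    zero    here       → Pj
    (suc a) (there a∈) → Pf a a∈

-- Codes of profiles

module _ {n} (G : Graph n) (R : TreeRepresentation G)
         {ℓ} (R≤ℓ : TreeRepresentation.repLength R ≤⁺ [ ℓ ]) (A : Subset n) (r : ℕ) where

  open TreeRepresentation R
  open Representation G R R≤ℓ

  private
    marks = List.map node (elements A)

  module _ (root : Fin nodes) where

    open RootedTree tree isTree root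
    open Gates

    -- A profile is determined by the gates that separate v from A, the distances
    -- d₁ and d₂ of v to their bags (capped at r + 1), and the defects f a ≤ ℓ of
    -- the routes from the vertices a through these bags.
    Code : Set
    Code = Gates × ℕ × ℕ × (Fin n → ℕ)

    decode : Code → Profile A
    decode (g , d₁ , d₂ , f) a _ =
      cap r [ bagDist r (gate g (node a)) a + (if isBelow g (node a) then d₁ else d₂) + f a ]

    defects : List (Fin n → ℕ)
    defects = choices A (ℓ + 1)

    distancesDefects : List (ℕ × (Fin n → ℕ))
    -- The cut-off distances run through 0, ..., r + 1.
    distancesDefects = List.cartesianProduct (List.upTo (2 + r)) defects

    distances²Defects : List (ℕ × ℕ × (Fin n → ℕ))
    distances²Defects = List.cartesianProduct (List.upTo (2 + r)) distancesDefects

    codes : List Code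
    codes = List.cartesianProduct (proj₁ (gates marks)) distances²Defects

    length-codes : length codes ≤ 3 * ∣ A ∣ * ((2 + r) * ((2 + r) * (ℓ + 1) ^ ∣ A ∣))
    length-codes = begin
      length codes
        ≡⟨ length-cartesianProductWith _,_ (proj₁ (gates marks)) distances²Defects ⟩
      length (proj₁ (gates marks)) * length distances²Defects
        ≤⟨ ℕ.*-monoˡ-≤ _ (proj₁ (proj₂ (gates marks))) ⟩
      3 * length marks * length distances²Defects
        ≡⟨ cong₂ (λ x y → 3 * x * y)
             (trans (length-map node (elements A)) (length-elements A))
             (trans (length-upTo-× (2 + r) distancesDefects)
               (cong ((2 + r) *_) (trans (length-upTo-× (2 + r) defects)
                 (cong ((2 + r) *_) (length-choices A (ℓ + 1)))))) ⟩
      3 * ∣ A ∣ * ((2 + r) * ((2 + r) * (ℓ + 1) ^ ∣ A ∣)) ∎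
      where
      open ℕ.≤-Reasoning
      length-upTo-× : ∀ {B : Set} m (ys : List B) →
                      length (List.cartesianProduct (List.upTo m) ys) ≡ m * length ys
      length-upTo-× m ys = trans (length-cartesianProductWith _,_ (List.upTo m) ys)
                                 (cong (_* length ys) (length-upTo m))

    -- The code of v consists of the gates for `node v`, the distances of v to both bags and the
    -- defects from `cap-dist`. The vertex `a₀` supplies the mark that `gates` asks for.
    profile-decoded : ∀ {a₀} → a₀ ∈ A → ∀ v → Any (profile r G A v ≈ₚ_) (List.map decode codes)
    profile-decoded a₀∈A v with proj₂ (proj₂ (gates marks)) (node v) (∈-map⁺ node (∈-elements a₀∈A))
    ... | g , g∈ , sep
      with choose A (λ a a∈A → cap-dist {root = root} {r = r} (sep (∈-map⁺ node (∈-elements a∈A))))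
    ...   | f , f∈ , f≡ = lose
      (∈-map⁺ decode (∈-cartesianProductWith⁺ _,_ g∈ (∈-cartesianProductWith⁺ _,_ (capped∈ (lower g))
        (∈-cartesianProductWith⁺ _,_ (capped∈ (upper g)) f∈))))
      λ a a∈A → trans (f≡ a a∈A)
        (cong (λ x → cap r [ bagDist r (gate g (node a)) a + x + f a ]) (distribute a))
      where
      capped∈ : ∀ t → bagDist r t v ∈ₗ List.upTo (2 + r)
      capped∈ t = ∈-upTo⁺ (s≤s (proj₁ (proj₂ (nearestInBag r t v))))
      distribute : ∀ a → bagDist r (gate g (node a)) v ≡
                   (if isBelow g (node a) then bagDist r (lower g) v else bagDist r (upper g) v)
      distribute a = if-float (λ t → bagDist r t v) (isBelow g (node a))

  profileCount-bound : 1 ≤ ∣ A ∣ → 1 ≤ r → profileCount r G A ≤ 27 * ∣ A ∣ * r ^ 2 * (ℓ + 1) ^ ∣ A ∣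
  profileCount-bound 1≤k 1≤r = begin
    profileCount r G A
      ≤⟨ profileCount-≤ (List.map (decode root) (codes root)) (profile-decoded root (proj₂ nonempty)) ⟩
    length (List.map (decode root) (codes root))
      ≡⟨ length-map (decode root) (codes root) ⟩
    length (codes root)
      ≤⟨ length-codes root ⟩
    3 * k * ((2 + r) * ((2 + r) * E))
      -- Since r ≥ 1, each factor 2 + r is at most 3r; with the 3k pairs of gates this gives 27 = 3
      -- · 3 · 3.
      ≤⟨ ℕ.*-monoʳ-≤ (3 * k) (ℕ.*-mono-≤ 2+r≤3r (ℕ.*-monoˡ-≤ E 2+r≤3r)) ⟩
    3 * k * (3 * r * (3 * r * E))
      ≡⟨ solve 3 (λ k r E → con 3 :* k :* (con 3 :* r :* (con 3 :* r :* E))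
                            := con 27 :* k :* r :^ 2 :* E) refl k r E ⟩
    27 * k * r ^ 2 * E ∎
    where
    open ℕ.≤-Reasoning
    open +-*-Solver
    k = ∣ A ∣
    E = (ℓ + 1) ^ k
    nonempty : Nonempty A
    nonempty = ∣p∣>0⇒Nonempty A 1≤k
    root : Fin nodes
    -- Any node can be the root; a vertex of `A` provides one.
    root = node (proj₁ nonempty)
    2+r≤3r : 2 + r ≤ 3 * r
    2+r≤3r = begin
      2 + r         ≤⟨ ℕ.+-monoˡ-≤ r (ℕ.*-monoʳ-≤ 2 1≤r) ⟩
      2 * r + r     ≡⟨ ℕ.+-comm (2 * r) r ⟩
      3 * r         ∎

theorem9 : ∃ λ (C : ℕ) → 0 < C ×
    (∀ (ℓ n : ℕ) (G : Graph n) → TreelengthAtMost G ℓ →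
    ∀ (r k : ℕ) → 1 ≤ r → 1 ≤ k → k ≤ n →
    profileComplexity r G k ≤ C * k * r ^ 2 * (ℓ + 1) ^ k)
theorem9 = 27 , s≤s z≤n , λ ℓ n G (R , R≤ℓ) r k 1≤r 1≤k k≤n →
  ExtremaNat.max≤v⁺ z≤n (All.map⁺ (All.map
    (λ { {A} refl → profileCount-bound G R R≤ℓ A r 1≤k 1≤r })
    (All.all-filter (λ A → ∣ A ∣ ℕ.≟ k) (subsets n))))
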